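{- There are infinitely many pairs $(x,y)$ of binary words such that $J_{\mathrm{rect}}(xy)<J_{\mathrm{rect}}(x)$ (i.e. infinitely many counterexamples to the statement "$J_{\mathrm{rect}}(x)\le J_{\mathrm{rect}}(xy)$ for all binary words $x,y$").
   Context: Words are finite strings over $\{0,1\}$ ($0$ = hydrophobic, $1$ = polar); $xy$ is concatenation. A fold of a word $w=w_1\cdots w_n$ in the 2D rectangular lattice $\mathbb Z^2$ is a self-avoiding walk $v_1,\dots,v_n$ (distinct vertices, $v_i$ adjacent to $v_{i+1}$); its score is the number of pairs $\{i,j\}$ with $|i-j|\ge 2$, $w_i=w_j=0$ and $v_i,v_j$ adjacent in $\mathbb Z^2$. $J_{\mathrm{rect}}(w)$ is the maximum score over all folds of $w$. -}

module Defs where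

open import Data.Nat using (ℕ; zero; suc; _+_; _≤_; _<_)
import Data.Nat as ℕ
open import Data.Integer using (ℤ; _-_; ∣_∣)
open import Data.Product using (_×_; _,_; Σ; ∃; ∃-syntax)
open import Data.List using (List; []; _∷_; length; zip; drop; _++_)
open import Data.List.Relation.Unary.Linked using (Linked)
open import Data.List.Relation.Unary.Unique.Propositional using (Unique)
open import Relation.Binary.PropositionalEquality using (_≡_)
open import Relation.Nullary.Decidable using (does)
open import Data.Bool using (if_then_else_)

-- Letters: H = 0 (hydrophobic), P = 1 (polar).
data Bit : Set where
  H P : Bit

Word : Set
Word = List Bit

Pt : Set
Pt = ℤ × ℤ

Adj : Pt → Pt → Set
Adj (a , b) (c , d) = ∣ a - c ∣ + ∣ b - d ∣ ≡ 1

adj? : Pt → Pt → ℕ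
adj? (a , b) (c , d) = if does ((∣ a - c ∣ + ∣ b - d ∣) ℕ.≟ 1) then 1 else 0

record Fold (w : Word) : Set where
  constructor fold
  field
    pos      : List Pt
    len      : length pos ≡ length w
    walk     : Linked Adj pos
    distinct : Unique pos
open Fold public

contactsWith : Pt → List (Bit × Pt) → ℕ
contactsWith p [] = 0
contactsWith p ((H , q) ∷ rest) = adj? p q + contactsWith p rest
contactsWith p ((P , q) ∷ rest) = contactsWith p rest

-- number of pairs i < j with j - i ≥ 2, w_i = w_j = H, v_i adjacent to v_j
scoreList : List (Bit × Pt) → ℕ
scoreList [] = 0
scoreList ((H , p) ∷ rest) = contactsWith p (drop 1 rest) + scoreList rest
scoreList ((P , p) ∷ rest) = scoreList rest

score : {w : Word} → Fold w → ℕ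
score {w} f = scoreList (zip w (pos f))

IsJrect : Word → ℕ → Set
IsJrect w k = (∃[ f ] score {w} f ≡ k) × (∀ (f : Fold w) → score f ≤ k)

module Submission where

-- In every fold the lattice is 2-coloured like a checkerboard and consecutive residues
-- have different colours, so the H's at positions 1, 3, 5, 7 of x = HPHPHPHH never touch
-- each other, and the only possible contacts are between v₈ and v₁, v₃, v₅.  Wrapping the
-- chain around v₈ realises all three, so J(x) = 3.  Once a polar tail y is appended, v₈ has
-- the two walk neighbours v₇ and v₉ besides its contact partners; a lattice point has only
-- four neighbours, so at most two of v₁, v₃, v₅ touch v₈ and J(xy) = 2.

open import Defs
open import Data.Bool using (Bool; true; not; _xor_; if_then_else_)
open import Data.Bool.Properties using (not-involutive; not-¬; not-distribˡ-xor; not-distribʳ-xor)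
open import Data.Fin using (Fin; zero; suc)
import Data.Fin.Properties as Fin
open import Data.Integer as ℤ using (ℤ; +_; -[1+_]; ∣_∣)
import Data.Integer.Properties as ℤ
open import Data.List using (List; []; _∷_; length; _++_; zip; replicate; applyUpTo)
open import Data.List.Properties using (length-replicate; length-applyUpTo)
open import Data.List.Membership.Propositional.Properties using (∈-applyUpTo⁻)
open import Data.List.Relation.Binary.Disjoint.Propositional using (Disjoint)
open import Data.List.Relation.Unary.All as All using (All; []; _∷_)
import Data.List.Relation.Unary.All.Properties as All
open import Data.List.Relation.Unary.AllPairs using (_∷_)
open import Data.List.Relation.Unary.Linked using (Linked; [-]; _∷_)
import Data.List.Relation.Unary.Linked.Properties as Linked
open import Data.List.Relation.Unary.Unique.Propositional using (Unique)
import Data.List.Relation.Unary.Unique.Propositional.Properties as Unique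
open import Data.Nat using (ℕ; zero; suc; _+_; _≤_; _<_; s≤s; z≤n)
import Data.Nat as ℕ
import Data.Nat.Properties as ℕ
open import Data.Nat.Tactic.RingSolver using (solve-∀)
open import Data.Product using (_×_; _,_; proj₁; proj₂; ∃-syntax)
open import Data.Product.Properties using (≡-dec)
open import Data.List.Relation.Unary.Unique.DecPropositional (≡-dec ℤ._≟_ ℤ._≟_) using (unique?)
open import Data.Vec using (Vec; []; _∷_; lookup)
open import Data.Vec.Relation.Unary.All as VecAll using ([]; _∷_)
open import Data.Vec.Relation.Unary.AllPairs using ([]; _∷_)
import Data.Vec.Relation.Unary.All.Properties as VecAll
import Data.Vec.Relation.Unary.Unique.Propositional as Vec
import Data.Vec.Relation.Unary.Unique.Propositional.Properties as Vec
open import Function using (_∘_)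
open import Relation.Binary.PropositionalEquality
open import Relation.Nullary using (¬_; Dec; yes; no; does; contradiction)
open import Relation.Nullary.Decidable using (from-yes)

isEven : ℕ → Bool
isEven zero = true
isEven (suc n) = not (isEven n)

isEvenℤ : ℤ → Bool
isEvenℤ (+ n) = isEven n
isEvenℤ -[1+ n ] = not (isEven n)

isEvenℤ-1+ : ∀ i → isEvenℤ (ℤ.1ℤ ℤ.+ i) ≡ not (isEvenℤ i)
isEvenℤ-1+ (+ n) = refl
isEvenℤ-1+ -[1+ zero ] = refl
isEvenℤ-1+ -[1+ suc n ] = sym (not-involutive _)

isEvenℤ-[-1]+ : ∀ i → isEvenℤ (ℤ.-1ℤ ℤ.+ i) ≡ not (isEvenℤ i)
isEvenℤ-[-1]+ (+ zero) = refl
isEvenℤ-[-1]+ (+ suc n) = sym (not-involutive _)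
isEvenℤ-[-1]+ -[1+ n ] = refl

isEvenℤ-0+ : ∀ i → isEvenℤ (ℤ.0ℤ ℤ.+ i) ≡ isEvenℤ i
isEvenℤ-0+ i = cong isEvenℤ (ℤ.+-identityˡ i)

colour : Pt → Bool
colour (a , b) = isEvenℤ a xor isEvenℤ b

unitVector : Fin 4 → Pt
unitVector zero = (ℤ.1ℤ , ℤ.0ℤ)
unitVector (suc zero) = (ℤ.-1ℤ , ℤ.0ℤ)
unitVector (suc (suc zero)) = (ℤ.0ℤ , ℤ.1ℤ)
unitVector (suc (suc (suc zero))) = (ℤ.0ℤ , ℤ.-1ℤ)

infixl 6 _+ᵥ_
_+ᵥ_ : Pt → Pt → Pt
(u , v) +ᵥ (a , b) = (u ℤ.+ a , v ℤ.+ b)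

norm₁≡1⇒unitVector : ∀ u v → ∣ u ∣ + ∣ v ∣ ≡ 1 → ∃[ d ] (u , v) ≡ unitVector d
norm₁≡1⇒unitVector (+ 1) (+ 0) _ = zero , refl
norm₁≡1⇒unitVector -[1+ 0 ] (+ 0) _ = suc zero , refl
norm₁≡1⇒unitVector (+ 0) (+ 1) _ = suc (suc zero) , refl
norm₁≡1⇒unitVector (+ 0) -[1+ 0 ] _ = suc (suc (suc zero)) , refl
norm₁≡1⇒unitVector (+ 0) (+ 0) ()
norm₁≡1⇒unitVector (+ 0) (+ suc (suc n)) ()
norm₁≡1⇒unitVector (+ 0) -[1+ suc n ] ()
norm₁≡1⇒unitVector (+ 1) (+ suc n) ()
norm₁≡1⇒unitVector (+ 1) -[1+ n ] ()
norm₁≡1⇒unitVector (+ suc (suc m)) v ()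
norm₁≡1⇒unitVector -[1+ 0 ] (+ suc n) ()
norm₁≡1⇒unitVector -[1+ 0 ] -[1+ n ] ()
norm₁≡1⇒unitVector -[1+ suc m ] v ()

i≡[i-j]+j : ∀ i j → i ≡ (i ℤ.- j) ℤ.+ j
i≡[i-j]+j i j = begin
  i                     ≡⟨ ℤ.+-identityʳ i ⟨
  i ℤ.+ ℤ.0ℤ            ≡⟨ cong (λ k → i ℤ.+ k) (ℤ.+-inverseˡ j) ⟨
  i ℤ.+ (ℤ.- j ℤ.+ j)   ≡⟨ ℤ.+-assoc i (ℤ.- j) j ⟨
  (i ℤ.- j) ℤ.+ j       ∎
  where open ≡-Reasoning

Adj⇒unitVector : ∀ q p → Adj q p → ∃[ d ] q ≡ unitVector d +ᵥ p
Adj⇒unitVector (a , b) (c , d) adj with norm₁≡1⇒unitVector (a ℤ.- c) (b ℤ.- d) adj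
... | dir , eq = dir , cong₂ _,_
  (trans (i≡[i-j]+j a c) (cong ((ℤ._+ c) ∘ proj₁) eq))
  (trans (i≡[i-j]+j b d) (cong ((ℤ._+ d) ∘ proj₂) eq))

Adj-sym : ∀ p q → Adj p q → Adj q p
Adj-sym (a , b) (c , d) = trans (cong₂ _+_ (ℤ.∣i-j∣≡∣j-i∣ c a) (ℤ.∣i-j∣≡∣j-i∣ d b))

colour-+ᵥ-unitVector : ∀ d p → colour (unitVector d +ᵥ p) ≡ not (colour p)
colour-+ᵥ-unitVector zero (a , b)
  rewrite isEvenℤ-1+ a | isEvenℤ-0+ b = sym (not-distribˡ-xor (isEvenℤ a) (isEvenℤ b))
colour-+ᵥ-unitVector (suc zero) (a , b)
  rewrite isEvenℤ-[-1]+ a | isEvenℤ-0+ b = sym (not-distribˡ-xor (isEvenℤ a) (isEvenℤ b))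
colour-+ᵥ-unitVector (suc (suc zero)) (a , b)
  rewrite isEvenℤ-0+ a | isEvenℤ-1+ b = sym (not-distribʳ-xor (isEvenℤ a) (isEvenℤ b))
colour-+ᵥ-unitVector (suc (suc (suc zero))) (a , b)
  rewrite isEvenℤ-0+ a | isEvenℤ-[-1]+ b = sym (not-distribʳ-xor (isEvenℤ a) (isEvenℤ b))

colour-Adj : ∀ p q → Adj p q → colour p ≡ not (colour q)
colour-Adj p q adj with Adj⇒unitVector p q adj
... | d , refl = colour-+ᵥ-unitVector d _

colour-Adj² : ∀ p q r → Adj p q → Adj q r → colour p ≡ colour r
colour-Adj² p q r p~q q~r =
  trans (colour-Adj p q p~q) (trans (cong not (colour-Adj q r q~r)) (not-involutive (colour r)))

Adj? : ∀ p q → Dec (Adj p q)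
Adj? (a , b) (c , d) = (∣ a ℤ.- c ∣ + ∣ b ℤ.- d ∣) ℕ.≟ 1

¬Adj⇒adj?≡0 : ∀ p q → ¬ Adj p q → adj? p q ≡ 0
¬Adj⇒adj?≡0 (a , b) (c , d) = indicator (∣ a ℤ.- c ∣ + ∣ b ℤ.- d ∣)
  where
  indicator : ∀ n → n ≢ 1 → (if does (n ℕ.≟ 1) then 1 else 0) ≡ 0
  indicator 0 _ = refl
  indicator 1 n≢1 = contradiction refl n≢1
  indicator (suc (suc _)) _ = refl

Adj⇒adj?≡1 : ∀ p q → Adj p q → adj? p q ≡ 1
Adj⇒adj?≡1 (a , b) (c , d) adj rewrite adj = refl

adj?≤1 : ∀ p q → adj? p q ≤ 1
adj?≤1 p q with Adj? p q
... | yes adj rewrite Adj⇒adj?≡1 p q adj = ℕ.≤-refl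
... | no ¬adj rewrite ¬Adj⇒adj?≡0 p q ¬adj = z≤n

sameColour⇒adj?≡0 : ∀ p q → colour p ≡ colour q → adj? p q ≡ 0
sameColour⇒adj?≡0 p q same = ¬Adj⇒adj?≡0 p q (λ adj → not-¬ same (colour-Adj p q adj))

adj?-sum≤2 : ∀ p q₁ q₂ q₃ → ¬ (Adj q₁ p × Adj q₂ p × Adj q₃ p) → adj? q₁ p + (adj? q₂ p + adj? q₃ p) ≤ 2
adj?-sum≤2 p q₁ q₂ q₃ ¬all with Adj? q₁ p | Adj? q₂ p | Adj? q₃ p
... | no ¬a₁ | _ | _ rewrite ¬Adj⇒adj?≡0 q₁ p ¬a₁ = ℕ.+-mono-≤ (adj?≤1 q₂ p) (adj?≤1 q₃ p)
... | yes a₁ | no ¬a₂ | _ rewrite Adj⇒adj?≡1 q₁ p a₁ | ¬Adj⇒adj?≡0 q₂ p ¬a₂ = s≤s (adj?≤1 q₃ p)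
... | yes a₁ | yes a₂ | no ¬a₃ rewrite Adj⇒adj?≡1 q₁ p a₁ | Adj⇒adj?≡1 q₂ p a₂ | ¬Adj⇒adj?≡0 q₃ p ¬a₃ = ℕ.≤-refl
... | yes a₁ | yes a₂ | yes a₃ = contradiction (a₁ , a₂ , a₃) ¬all

neighbours≤4 : ∀ {n} p {qs : Vec Pt n} → Vec.Unique qs → VecAll.All (λ q → Adj q p) qs → n ≤ 4
neighbours≤4 {n} p {qs} distinct adjacent = ℕ.≮⇒≥ more-than-4-impossible
  where
  direction : Fin n → Fin 4
  direction i = proj₁ (Adj⇒unitVector (lookup qs i) p (VecAll.lookup⁺ adjacent i))

  offset : ∀ i → lookup qs i ≡ unitVector (direction i) +ᵥ p
  offset i = proj₂ (Adj⇒unitVector (lookup qs i) p (VecAll.lookup⁺ adjacent i))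

  more-than-4-impossible : ¬ 4 < n
  more-than-4-impossible 4<n =
    let i , j , i<j , sameDirection = Fin.pigeonhole 4<n direction in
    Fin.<⇒≢ i<j (Vec.lookup-injective distinct i j
      (trans (offset i) (trans (cong (λ d → unitVector d +ᵥ p) sameDirection) (sym (offset j)))))

∣1+n⊖n∣≡1 : ∀ n → ∣ suc n ℤ.⊖ n ∣ ≡ 1
∣1+n⊖n∣≡1 zero = refl
∣1+n⊖n∣≡1 (suc n) = trans (cong ∣_∣ (ℤ.[1+m]⊖[1+n]≡m⊖n (suc n) n)) (∣1+n⊖n∣≡1 n)

southRayPoint : ℕ → Pt
southRayPoint j = (ℤ.0ℤ , -[1+ j ])

southRay : ℕ → List Pt
southRay = applyUpTo southRayPoint

southRay-linked : ∀ n → Linked Adj (southRay n)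
southRay-linked n = Linked.applyUpTo⁺₂ southRayPoint n (λ i → ∣1+n⊖n∣≡1 (suc i))

southRay-unique : ∀ n → Unique (southRay n)
southRay-unique n = Unique.applyUpTo⁺₁ southRayPoint n (λ i<j _ eq → ℕ.<⇒≢ i<j (ℤ.-[1+-injective (cong proj₂ eq)))

upperHalfPlane-disjoint-southRay : ∀ {xs} n → All (ℤ.NonNegative ∘ proj₂) xs → Disjoint xs (southRay n)
upperHalfPlane-disjoint-southRay n nonNegative (v∈xs , v∈ray) with ∈-applyUpTo⁻ southRayPoint v∈ray
... | _ , _ , refl = ℤ.NonNegative.nonNeg (All.lookup nonNegative v∈xs)

Polar : List (Bit × Pt) → Set
Polar = All ((_≡ P) ∘ proj₁)

zip-replicate-Polar : ∀ m qs → Polar (zip (replicate m P) qs)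
zip-replicate-Polar zero qs = []
zip-replicate-Polar (suc m) [] = []
zip-replicate-Polar (suc m) (q ∷ qs) = refl ∷ zip-replicate-Polar m qs

contactsWith-Polar : ∀ p {xs} → Polar xs → contactsWith p xs ≡ 0
contactsWith-Polar p [] = refl
contactsWith-Polar p (refl ∷ polar) = contactsWith-Polar p polar

scoreList-Polar : ∀ {xs} → Polar xs → scoreList xs ≡ 0
scoreList-Polar [] = refl
scoreList-Polar (refl ∷ polar) = scoreList-Polar polar

HPHPHPHH : Word
HPHPHPHH = H ∷ P ∷ H ∷ P ∷ H ∷ P ∷ H ∷ H ∷ []

-- The odd-indexed H's share a colour, so v₈ is the only possible contact partner.
score-HPHPHPHH-Pᵐ : ∀ m {v₁ v₂ v₃ v₄ v₅ v₆ v₇ v₈} rest →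
  Linked Adj (v₁ ∷ v₂ ∷ v₃ ∷ v₄ ∷ v₅ ∷ v₆ ∷ v₇ ∷ v₈ ∷ rest) →
  scoreList (zip (HPHPHPHH ++ replicate m P) (v₁ ∷ v₂ ∷ v₃ ∷ v₄ ∷ v₅ ∷ v₆ ∷ v₇ ∷ v₈ ∷ rest))
    ≡ adj? v₁ v₈ + (adj? v₃ v₈ + adj? v₅ v₈)
score-HPHPHPHH-Pᵐ m {v₁} {v₂} {v₃} {v₄} {v₅} {v₆} {v₇} {v₈} rest (a₁₂ ∷ a₂₃ ∷ a₃₄ ∷ a₄₅ ∷ a₅₆ ∷ a₆₇ ∷ _)
  with colour-Adj² v₁ v₂ v₃ a₁₂ a₂₃ | colour-Adj² v₃ v₄ v₅ a₃₄ a₄₅ | colour-Adj² v₅ v₆ v₇ a₅₆ a₆₇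
     | zip-replicate-Polar m rest
... | c₁₃ | c₃₅ | c₅₇ | tail
  rewrite sameColour⇒adj?≡0 v₁ v₃ c₁₃ | sameColour⇒adj?≡0 v₃ v₅ c₃₅ | sameColour⇒adj?≡0 v₅ v₇ c₅₇
        | sameColour⇒adj?≡0 v₁ v₅ (trans c₁₃ c₃₅) | sameColour⇒adj?≡0 v₃ v₇ (trans c₃₅ c₅₇)
        | sameColour⇒adj?≡0 v₁ v₇ (trans c₁₃ (trans c₃₅ c₅₇))
        | contactsWith-Polar v₁ tail | contactsWith-Polar v₃ tail | contactsWith-Polar v₅ tail
        | contactsWith-Polar v₇ tail | contactsWith-Polar v₈ (All.drop⁺ 1 tail) | scoreList-Polar tail
  = drop-+0 (adj? v₁ v₈) (adj? v₃ v₈) (adj? v₅ v₈)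
  where
  drop-+0 : ∀ a b c → a + 0 + (b + 0 + (c + 0 + 0)) ≡ a + (b + c)
  drop-+0 = solve-∀

score-HPHPHPHH-Pᵐ≤3 : ∀ m (f : Fold (HPHPHPHH ++ replicate m P)) → score f ≤ 3
score-HPHPHPHH-Pᵐ≤3 m f@(fold (v₁ ∷ _ ∷ v₃ ∷ _ ∷ v₅ ∷ _ ∷ _ ∷ v₈ ∷ rest) _ walk _) = begin
  score f                                 ≡⟨ score-HPHPHPHH-Pᵐ m rest walk ⟩
  adj? v₁ v₈ + (adj? v₃ v₈ + adj? v₅ v₈)  ≤⟨ ℕ.+-mono-≤ (adj?≤1 v₁ v₈) (ℕ.+-mono-≤ (adj?≤1 v₃ v₈) (adj?≤1 v₅ v₈)) ⟩
  3                                       ∎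
  where open ℕ.≤-Reasoning

score-HPHPHPHH-P¹⁺ᵐ≤2 : ∀ m (f : Fold (HPHPHPHH ++ replicate (suc m) P)) → score f ≤ 2
score-HPHPHPHH-P¹⁺ᵐ≤2 m f@(fold (v₁ ∷ _ ∷ v₃ ∷ _ ∷ v₅ ∷ _ ∷ v₇ ∷ v₈ ∷ v₉ ∷ rest) _
    walk@(_ ∷ _ ∷ _ ∷ _ ∷ _ ∷ _ ∷ a₇₈ ∷ a₈₉ ∷ _)
    ((_ ∷ n₁₃ ∷ _ ∷ n₁₅ ∷ _ ∷ n₁₇ ∷ _ ∷ n₁₉ ∷ _) ∷ _ ∷ (_ ∷ n₃₅ ∷ _ ∷ n₃₇ ∷ _ ∷ n₃₉ ∷ _) ∷ _ ∷
     (_ ∷ n₅₇ ∷ _ ∷ n₅₉ ∷ _) ∷ _ ∷ (_ ∷ n₇₉ ∷ _) ∷ _)) = begin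
  score f                                 ≡⟨ score-HPHPHPHH-Pᵐ (suc m) (v₉ ∷ rest) walk ⟩
  adj? v₁ v₈ + (adj? v₃ v₈ + adj? v₅ v₈)  ≤⟨ adj?-sum≤2 v₈ v₁ v₃ v₅ five-neighbours-impossible ⟩
  2                                       ∎
  where
  open ℕ.≤-Reasoning
  odd-distinct : Vec.Unique (v₁ ∷ v₃ ∷ v₅ ∷ v₇ ∷ v₉ ∷ [])
  odd-distinct = (n₁₃ ∷ n₁₅ ∷ n₁₇ ∷ n₁₉ ∷ []) ∷ (n₃₅ ∷ n₃₇ ∷ n₃₉ ∷ []) ∷ (n₅₇ ∷ n₅₉ ∷ []) ∷ (n₇₉ ∷ []) ∷ [] ∷ []
  five-neighbours-impossible : ¬ (Adj v₁ v₈ × Adj v₃ v₈ × Adj v₅ v₈)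
  five-neighbours-impossible (a₁₈ , a₃₈ , a₅₈) = ℕ.<-irrefl refl
    (neighbours≤4 v₈ odd-distinct (a₁₈ ∷ a₃₈ ∷ a₅₈ ∷ a₇₈ ∷ Adj-sym v₈ v₉ a₈₉ ∷ []))

-- v₃, …, v₈ of both optimal folds; v₈ = (0,0) touches v₃ and v₅, and touches v₁ only in the fold of x.
hairpin : List Pt
hairpin = (ℤ.1ℤ , ℤ.0ℤ) ∷ (ℤ.1ℤ , ℤ.1ℤ) ∷ (ℤ.0ℤ , ℤ.1ℤ) ∷ (ℤ.-1ℤ , ℤ.1ℤ) ∷ (ℤ.-1ℤ , ℤ.0ℤ) ∷ (ℤ.0ℤ , ℤ.0ℤ) ∷ []

fold-HPHPHPHH : Fold HPHPHPHH
fold-HPHPHPHH = fold positions refl (refl ∷ refl ∷ refl ∷ refl ∷ refl ∷ refl ∷ refl ∷ [-]) (from-yes (unique? positions))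
  where
  positions : List Pt
  positions = (ℤ.0ℤ , ℤ.-1ℤ) ∷ (ℤ.1ℤ , ℤ.-1ℤ) ∷ hairpin

fold-HPHPHPHH-P¹⁺ᵐ : ∀ m → Fold (HPHPHPHH ++ replicate (suc m) P)
fold-HPHPHPHH-P¹⁺ᵐ m = fold (prefix ++ southRay (suc m))
  (cong (λ n → 8 + n) (trans (length-applyUpTo southRayPoint (suc m)) (sym (length-replicate (suc m)))))
  (refl ∷ refl ∷ refl ∷ refl ∷ refl ∷ refl ∷ refl ∷ refl ∷ southRay-linked (suc m))
  (Unique.++⁺ (from-yes (unique? prefix)) (southRay-unique (suc m))
    (upperHalfPlane-disjoint-southRay (suc m) (_ ∷ _ ∷ _ ∷ _ ∷ _ ∷ _ ∷ _ ∷ _ ∷ [])))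
  where
  prefix : List Pt
  prefix = (+ 2 , ℤ.1ℤ) ∷ (+ 2 , ℤ.0ℤ) ∷ hairpin

Jrect-HPHPHPHH : IsJrect HPHPHPHH 3
Jrect-HPHPHPHH = (fold-HPHPHPHH , refl) , score-HPHPHPHH-Pᵐ≤3 0

Jrect-HPHPHPHH-P¹⁺ᵐ : ∀ m → IsJrect (HPHPHPHH ++ replicate (suc m) P) 2
Jrect-HPHPHPHH-P¹⁺ᵐ m =
  (fold-HPHPHPHH-P¹⁺ᵐ m , score-HPHPHPHH-Pᵐ (suc m) (southRay (suc m)) (walk (fold-HPHPHPHH-P¹⁺ᵐ m))) ,
  score-HPHPHPHH-P¹⁺ᵐ≤2 m

theorem2p19 : ∀ (N : ℕ) → ∃[ x ] ∃[ y ] ∃[ a ] ∃[ b ]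
                (N ≤ length x + length y) × IsJrect (x ++ y) a × IsJrect x b × a < b
theorem2p19 N =
  HPHPHPHH , replicate (suc N) P , 2 , 3 , N≤length , Jrect-HPHPHPHH-P¹⁺ᵐ N , Jrect-HPHPHPHH , ℕ.n<1+n 2
  where
  open ℕ.≤-Reasoning
  N≤length : N ≤ length HPHPHPHH + length (replicate (suc N) P)
  N≤length = begin
    N                             <⟨ ℕ.n<1+n N ⟩
    suc N                         ≡⟨ length-replicate (suc N) ⟨
    length (replicate (suc N) P)  ≤⟨ ℕ.m≤n+m _ 8 ⟩
    8 + length (replicate (suc N) P) ∎
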